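{- Let $\chi:[n]_3\to\{+,-\}$ be a generalized signotope, and let $A,B\subseteq[n]$ be two non-empty sets. If for every $C\subseteq A\cup B$ with $|C|=4$, the sets $A\cap C$ and $B\cap C$ are separable, then $A$ and $B$ are strongly separable.
   Context: Here $[n]=\{1,2,\ldots,n\}$, and $[n]_3$ denotes the set of all triples $(a,b,c)$ with pairwise distinct $a,b,c\in[n]$. A map $\chi:[n]_3\to\{+,-\}$ is alternating if $\chi(i_{\sigma(1)},i_{\sigma(2)},i_{\sigma(3)})=\operatorname{sgn}(\sigma)\cdot\chi(i_1,i_2,i_3)$ for any distinct $i_1,i_2,i_3\in[n]$ and any permutation $\sigma\in S_3$. A generalized signotope on $n$ elements is an alternating map $\chi:[n]_3\to\{+,-\}$ such that for any pairwise different $a,b,c,d\in[n]$ the sequence $\chi(a,b,c),\chi(a,b,d),\chi(a,c,d),\chi(b,c,d)$ has at most two sign changes (equivalently, it is neither $+-+-$ nor $-+-+$). Two sets $A,B\subseteq[n]$ are separable (with respect to $\chi$) if there exist $i,j\in A\cup B$ such that $\chi(i,j,x)=+$ for all $x\in A\setminus\{i,j\}$ and $\chi(i,j,x)=-$ for all $x\in B\setminus\{i,j\}$; in this case one says that $ij$ separates $A$ from $B$. If moreover such $i,j$ can be found with $i\in A$ and $j\in B$, then $A$ and $B$ are strongly separable.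
   Formalization: The cases A = B with |A| = 1 or |A| = 3 are excluded, and i, j are required to be distinct: in these cases there is no 4-element C, so the condition is vacuous, yet A and B are not strongly separable. -}

module Defs where

open import Data.Fin.Base using (Fin; _<_)
open import Data.Fin.Patterns using (0F; 1F; 2F)
open import Data.Fin.Permutation as Perm using (Permutation′; _⟨$⟩ʳ_; _⟨$⟩ˡ_)
open import Data.Fin.Properties using (_≟_; _<?_)
open import Data.Fin.Subset
  using (Subset; inside; outside; _∈_; _⊆_; _∪_; _-_; ∣_∣; ⁅_⁆)
open import Data.Fin.Subset.Properties
  using (x∈p⇒∣p-x∣<∣p∣; x∈p∧x≢y⇒x∈p-y; p⊆q⇒∣p∣≤∣q∣; ∪-idem; ∣⁅x⁆∣≡1; x∈⁅x⁆; x∈p∪q⁺)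
open import Data.Nat.Base using (ℕ; suc; _+_; _≤_; z≤n; s≤s)
open import Data.Nat.Properties as ℕ using ()
open import Data.Product.Base using (Σ-syntax; ∃-syntax; _×_; _,_)
open import Data.Sign.Base as Sign using (Sign)
open import Data.Sign.Properties as Sign using ()
open import Data.Sum.Base using (_⊎_; inj₁; inj₂)
open import Data.Vec.Base using (Vec; []; _∷_; lookup; tabulate)
open import Data.Vec.Relation.Unary.All using ([]; _∷_)
open import Data.Vec.Relation.Unary.AllPairs using ([]; _∷_)
open import Data.Vec.Relation.Unary.Unique.Propositional using (Unique)
open import Data.Vec.Relation.Unary.Unique.Propositional.Properties
  using (tabulate⁺; lookup-injective)
open import Relation.Binary.PropositionalEquality
  using (_≡_; _≢_; refl; sym; trans; cong; cong₂; subst; subst₂; ≢-sym)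
open import Relation.Nullary using (¬_; yes; no; contradiction)

private
  variable
    n : ℕ

-- Distinctness is irrelevant, so a map out of [ n ]₃ depends on the entries only.
record [_]₃ (n : ℕ) : Set where
  constructor mk
  field
    entries   : Vec (Fin n) 3
    .distinct : Unique entries

open [_]₃ public

triple : (a b c : Fin n) → .(a ≢ b) → .(a ≢ c) → .(b ≢ c) → [ n ]₃
triple a b c a≢b a≢c b≢c =
  mk (a ∷ b ∷ c ∷ []) ((a≢b ∷ a≢c ∷ []) ∷ (b≢c ∷ []) ∷ [] ∷ [])

-- (i₁ , i₂ , i₃) ↦ (i_σ(1) , i_σ(2) , i_σ(3))
permute : Permutation′ 3 → [ n ]₃ → [ n ]₃
permute σ (mk v v-distinct) =
  mk (tabulate (λ k → lookup v (σ ⟨$⟩ʳ k)))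
     (tabulate⁺ λ {i} {j} eq → σ-injective (lookup-injective v-distinct _ _ eq))
  where
  σ-injective : ∀ {i j} → σ ⟨$⟩ʳ i ≡ σ ⟨$⟩ʳ j → i ≡ j
  σ-injective {i} {j} eq =
    trans (sym (Perm.inverseˡ σ)) (trans (cong (σ ⟨$⟩ˡ_) eq) (Perm.inverseˡ σ))

-- The contribution of the positions i < j to (-1) ^ (number of inversions of σ).
inversionSign : Permutation′ 3 → Fin 3 → Fin 3 → Sign
inversionSign σ i j with (σ ⟨$⟩ʳ j) <? (σ ⟨$⟩ʳ i)
... | yes _ = Sign.-
... | no  _ = Sign.+

sgn : Permutation′ 3 → Sign
sgn σ = inversionSign σ 0F 1F Sign.* inversionSign σ 0F 2F Sign.* inversionSign σ 1F 2F

Alternating : ([ n ]₃ → Sign) → Set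
Alternating χ = ∀ σ t → χ (permute σ t) ≡ sgn σ Sign.* χ t

signChange : Sign → Sign → ℕ
signChange s t with s Sign.≟ t
... | yes _ = 0
... | no  _ = 1

signChanges : ∀ {m} → Vec Sign m → ℕ
signChanges []           = 0
signChanges (s ∷ [])     = 0
signChanges (s ∷ t ∷ ss) = signChange s t + signChanges (t ∷ ss)

record IsGeneralizedSignotope (χ : [ n ]₃ → Sign) : Set where
  field
    alternating : Alternating χ
    atMostTwo   : ∀ a b c d
      (a≢b : a ≢ b) (a≢c : a ≢ c) (a≢d : a ≢ d)
      (b≢c : b ≢ c) (b≢d : b ≢ d) (c≢d : c ≢ d) →
      signChanges ( χ (triple a b c a≢b a≢c b≢c)
                  ∷ χ (triple a b d a≢b a≢d b≢d)
                  ∷ χ (triple a c d a≢c a≢d c≢d)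
                  ∷ χ (triple b c d b≢c b≢d c≢d)
                  ∷ []) ≤ 2

-- "ij separates A from B".  The pair has i ≢ j because χ(i,j,x) is defined
-- only for pairwise distinct i, j, x.
Separates : ([ n ]₃ → Sign) → (i j : Fin n) → (A B : Subset n) → Set
Separates χ i j A B = Σ[ i≢j ∈ i ≢ j ]
  (∀ x → x ∈ A → (i≢x : i ≢ x) (j≢x : j ≢ x) → χ (triple i j x i≢j i≢x j≢x) ≡ Sign.+) ×
  (∀ x → x ∈ B → (i≢x : i ≢ x) (j≢x : j ≢ x) → χ (triple i j x i≢j i≢x j≢x) ≡ Sign.-)

Separable : ([ n ]₃ → Sign) → (A B : Subset n) → Set
Separable χ A B = ∃[ i ] ∃[ j ] i ∈ A ∪ B × j ∈ A ∪ B × Separates χ i j A B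

StronglySeparable : ([ n ]₃ → Sign) → (A B : Subset n) → Set
StronglySeparable χ A B = ∃[ i ] ∃[ j ] i ∈ A × j ∈ B × Separates χ i j A B

-- Pairs of sets with fewer than four elements in total that are never strongly
-- separable.  For these the condition on four-element subsets of A ∪ B is vacuous
-- (`exceptional⇒no-4-subset`) while strong separability fails
-- (`exceptional⇒¬stronglySeparable`), so they must be excluded.
Exceptional : (A B : Subset n) → Set
Exceptional A B = A ≡ B × (∣ A ∣ ≡ 1 ⊎ ∣ A ∣ ≡ 3)

exceptional⇒no-4-subset : {A B : Subset n} → Exceptional A B →
                          ∀ C → C ⊆ A ∪ B → ∣ C ∣ ≢ 4
exceptional⇒no-4-subset {A = A} (refl , size) C C⊆A∪A ∣C∣≡4
  with subst (4 ≤_) (cong ∣_∣ (∪-idem A)) (subst (_≤ ∣ A ∪ A ∣) ∣C∣≡4 (p⊆q⇒∣p∣≤∣q∣ C⊆A∪A))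
... | 4≤∣A∣ with size
...   | inj₁ ∣A∣≡1 = contradiction (subst (4 ≤_) ∣A∣≡1 4≤∣A∣) λ { (s≤s ()) }
...   | inj₂ ∣A∣≡3 = contradiction (subst (4 ≤_) ∣A∣≡3 4≤∣A∣) λ { (s≤s (s≤s (s≤s ()))) }

private
  ∣p∪q∣≤∣p∣+∣q∣ : (p q : Subset n) → ∣ p ∪ q ∣ ≤ ∣ p ∣ + ∣ q ∣
  ∣p∪q∣≤∣p∣+∣q∣ []            []            = z≤n
  ∣p∪q∣≤∣p∣+∣q∣ (outside ∷ p) (outside ∷ q) = ∣p∪q∣≤∣p∣+∣q∣ p q
  ∣p∪q∣≤∣p∣+∣q∣ (outside ∷ p) (inside  ∷ q) =
    subst (suc ∣ p ∪ q ∣ ≤_) (sym (ℕ.+-suc ∣ p ∣ ∣ q ∣)) (s≤s (∣p∪q∣≤∣p∣+∣q∣ p q))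
  ∣p∪q∣≤∣p∣+∣q∣ (inside  ∷ p) (outside ∷ q) = s≤s (∣p∪q∣≤∣p∣+∣q∣ p q)
  ∣p∪q∣≤∣p∣+∣q∣ (inside  ∷ p) (inside  ∷ q) =
    s≤s (ℕ.≤-trans (∣p∪q∣≤∣p∣+∣q∣ p q) (ℕ.+-monoʳ-≤ ∣ p ∣ (ℕ.n≤1+n ∣ q ∣)))

exceptional⇒¬stronglySeparable : (χ : [ n ]₃ → Sign) {A B : Subset n} →
                                 Exceptional A B → ¬ StronglySeparable χ A B
exceptional⇒¬stronglySeparable χ {A} (refl , inj₁ ∣A∣≡1) (i , j , i∈A , j∈A , i≢j , _)
  with subst (suc ∣ A - i ∣ ≤_) ∣A∣≡1 (x∈p⇒∣p-x∣<∣p∣ i∈A)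
     | x∈p⇒∣p-x∣<∣p∣ (x∈p∧x≢y⇒x∈p-y j∈A (≢-sym i≢j))
... | s≤s ∣A-i∣≤0 | 0<∣A-i∣ = contradiction (ℕ.≤-trans 0<∣A-i∣ ∣A-i∣≤0) λ ()
exceptional⇒¬stronglySeparable χ {A} (refl , inj₂ ∣A∣≡3) (i , j , _ , _ , i≢j , pos , neg) =
  contradiction 3≤2 λ { (s≤s (s≤s ())) }
  where
  A⊆ij : A ⊆ ⁅ i ⁆ ∪ ⁅ j ⁆
  A⊆ij {x} x∈A with i ≟ x | j ≟ x
  ... | yes refl | _        = x∈p∪q⁺ (inj₁ (x∈⁅x⁆ i))
  ... | no _     | yes refl = x∈p∪q⁺ (inj₂ (x∈⁅x⁆ j))
  ... | no i≢x   | no j≢x   =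
    contradiction (trans (sym (pos x x∈A i≢x j≢x)) (neg x x∈A i≢x j≢x)) λ ()

  3≤2 : 3 ≤ 2
  3≤2 = subst₂ _≤_ ∣A∣≡3 (cong₂ _+_ (∣⁅x⁆∣≡1 i) (∣⁅x⁆∣≡1 j))
          (ℕ.≤-trans (p⊆q⇒∣p∣≤∣q∣ A⊆ij) (∣p∪q∣≤∣p∣+∣q∣ ⁅ i ⁆ ⁅ j ⁆))

{-# OPTIONS --safe #-}
module Submission where

-- For a fixed a ∈ A, the relation χ(a,y,z) = + orients the pairs of B, and separability
-- of 4-sets forbids cyclic triples; so some b ∈ B has χ(a,b,z) = − for all other z ∈ B.
-- If A and B are disjoint, start from such a pair ab and suppose a′ ∈ A lies on the wrong
-- side of it.  Replacing a by a′, and b by the element b′ belonging to a′, repairs a′ and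
-- keeps every element of A that was already on the right side, so that finitely many
-- replacements end in a separating pair.  If x ∈ A ∩ B, then x has to be one of the two
-- ends, and only two candidates for the other end are left: the elements which the
-- argument above attaches to x in B and in A.

open import Defs
open import Data.Fin.Base using (Fin; zero; suc)
open import Data.Fin.Patterns using (0F; 1F; 2F)
open import Data.Fin.Permutation using (transpose)
open import Data.Fin.Properties using (_≟_; any?)
open import Data.Fin.Subset using (Subset; inside; outside; ⋃; ⁅_⁆; _∈_; _∉_; _⊆_; _∪_; _∩_; ∣_∣; Nonempty)
open import Data.Fin.Subset.Properties
  using (_∈?_; ∉⊥; ∣⊥∣≡0; x∈⁅x⁆; x∈⁅y⁆⇒x≡y; x∈p∪q⁺; x∈p∪q⁻; x∈p∩q⁺; x∈p∩q⁻; ⊆-antisym; ∪-identityˡ)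
open import Data.List.Base using (List; []; _∷_; length; map; allFin)
open import Data.List.Membership.DecPropositional using () renaming (_∈?_ to member?)
open import Data.List.Membership.Propositional using () renaming (_∈_ to _∈ₗ_)
open import Data.List.Membership.Propositional.Properties using (∈-allFin)
open import Data.List.Relation.Unary.All as All using (All; []; _∷_)
open import Data.List.Relation.Unary.All.Properties using (All¬⇒¬Any; ¬Any⇒All¬)
open import Data.List.Relation.Unary.AllPairs using ([]; _∷_)
open import Data.List.Relation.Unary.Any using (here; there)
open import Data.List.Relation.Unary.Unique.Propositional using (Unique)
open import Data.Nat.Base using (ℕ; suc; _≤_; s≤s)
open import Data.Product.Base using (∃-syntax; _×_; _,_; proj₁; proj₂)
open import Data.Sign.Base as Sign using (Sign)
open import Data.Sign.Properties as Sign using ()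
open import Data.Sum.Base as Sum using (_⊎_; inj₁; inj₂; [_,_]′)
open import Data.Vec.Base as Vec using ([]; _∷_)
open import Function.Base using (_∘_)
open import Relation.Binary.PropositionalEquality using (_≡_; _≢_; refl; sym; trans; cong; ≢-sym)
open import Relation.Nullary using (¬_; Dec; yes; no; contradiction)
open import Relation.Nullary.Decidable using (¬?; _×-dec_; map′; decidable-stable)

private
  variable
    n : ℕ

-- Finite iteration, and subsets given by duplicate-free lists.

pattern 0th = here refl
pattern 1st = there 0th
pattern 2nd = there 1st
pattern 3rd = there 2nd

-- A repair at y undoes nothing achieved before, so a single pass over `Fin n` suffices and no
-- decreasing measure has to be found.
exhaust : {S : Set} {R : S → Fin n → Set} →
          (∀ s y → ∃[ s′ ] R s′ y × (∀ {z} → R s z → R s′ z)) →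
          S → ∃[ s ] (∀ y → R s y)
exhaust {S = S} {R} improve s₀ with loop (allFin _)
  where
  loop : ∀ ys → ∃[ s ] All (R s) ys
  loop []       = s₀ , []
  loop (y ∷ ys) with loop ys
  ... | s , done with improve s y
  ...   | s′ , new , keep = s′ , new ∷ All.map keep done
... | s , done = s , λ y → All.lookup done (∈-allFin y)

fromList : List (Fin n) → Subset n
fromList = ⋃ ∘ map ⁅_⁆

∈-fromList⁺ : ∀ {x : Fin n} {xs} → x ∈ₗ xs → x ∈ fromList xs
∈-fromList⁺ 0th       = x∈p∪q⁺ (inj₁ (x∈⁅x⁆ _))
∈-fromList⁺ (there i) = x∈p∪q⁺ (inj₂ (∈-fromList⁺ i))

∈-fromList⁻ : ∀ {x : Fin n} xs → x ∈ fromList xs → x ∈ₗ xs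
∈-fromList⁻ []       i = contradiction i ∉⊥
∈-fromList⁻ (y ∷ xs) i with x∈p∪q⁻ ⁅ y ⁆ _ i
... | inj₁ j = here (x∈⁅y⁆⇒x≡y y j)
... | inj₂ j = there (∈-fromList⁻ xs j)

x∉p⇒∣⁅x⁆∪p∣≡1+∣p∣ : (x : Fin n) (p : Subset n) → x ∉ p → ∣ ⁅ x ⁆ ∪ p ∣ ≡ suc ∣ p ∣
x∉p⇒∣⁅x⁆∪p∣≡1+∣p∣ zero    (outside ∷ p) x∉p = cong (suc ∘ ∣_∣) (∪-identityˡ p)
x∉p⇒∣⁅x⁆∪p∣≡1+∣p∣ zero    (inside  ∷ p) x∉p = contradiction Vec.here x∉p
x∉p⇒∣⁅x⁆∪p∣≡1+∣p∣ (suc x) (outside ∷ p) x∉p = x∉p⇒∣⁅x⁆∪p∣≡1+∣p∣ x p (x∉p ∘ Vec.there)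
x∉p⇒∣⁅x⁆∪p∣≡1+∣p∣ (suc x) (inside  ∷ p) x∉p = cong suc (x∉p⇒∣⁅x⁆∪p∣≡1+∣p∣ x p (x∉p ∘ Vec.there))

∣fromList∣ : ∀ {xs : List (Fin n)} → Unique xs → ∣ fromList xs ∣ ≡ length xs
∣fromList∣ {n = n} []             = ∣⊥∣≡0 n
∣fromList∣ {xs = x ∷ xs} (x≢ ∷ u) =
  trans (x∉p⇒∣⁅x⁆∪p∣≡1+∣p∣ x _ (All¬⇒¬Any x≢ ∘ ∈-fromList⁻ xs)) (cong suc (∣fromList∣ u))

+-+-⇒≰2 : ∀ {s₁ s₂ s₃ s₄} → s₁ ≡ Sign.+ → s₂ ≡ Sign.- → s₃ ≡ Sign.+ → s₄ ≡ Sign.- →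
          ¬ signChanges (s₁ ∷ s₂ ∷ s₃ ∷ s₄ ∷ []) ≤ 2
+-+-⇒≰2 refl refl refl refl (s≤s (s≤s ()))

module _ {A B : Subset n} where

  enumeration : ∀ {xs} → Unique xs → All (_∈ A) xs → All (_∈ B) xs →
                (∀ {w} → w ∈ A ⊎ w ∈ B → w ∈ₗ xs) → A ≡ B × ∣ A ∣ ≡ length xs
  enumeration {xs} u xs⊆A xs⊆B cover =
    trans A≡xs (sym B≡xs) , trans (cong ∣_∣ A≡xs) (∣fromList∣ u)
    where
    A≡xs : A ≡ fromList xs
    A≡xs = ⊆-antisym (∈-fromList⁺ ∘ cover ∘ inj₁) (All.lookup xs⊆A ∘ ∈-fromList⁻ xs)
    B≡xs : B ≡ fromList xs
    B≡xs = ⊆-antisym (∈-fromList⁺ ∘ cover ∘ inj₂) (All.lookup xs⊆B ∘ ∈-fromList⁻ xs)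

-- Orientations of triples.

module GeneralizedSignotope {n : ℕ} {χ : [ n ]₃ → Sign} (signotope : IsGeneralizedSignotope χ) where

  open IsGeneralizedSignotope signotope

  private
    variable
      a b c d i j x : Fin n
      A B : Subset n

  -- The distinctness proofs travel with the sign, so degenerate triples are never positive. A
  -- negative sign is expressed as `Positive` with two entries exchanged.
  record Positive (a b c : Fin n) : Set where
    constructor positive
    field
      a≢b : a ≢ b
      a≢c : a ≢ c
      b≢c : b ≢ c
      χ≡+ : χ (triple a b c a≢b a≢c b≢c) ≡ Sign.+

  open Positive

  -- A concrete transposition and its `sgn` both compute, and distinctness is irrelevant, so
  -- `alternating` applies up to definitional equality.
  swap₀₁ : (p : a ≢ b) (q : a ≢ c) (r : b ≢ c) →
           χ (triple b a c (≢-sym p) r q) ≡ Sign.opposite (χ (triple a b c p q r))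
  swap₀₁ p q r = alternating (transpose 0F 1F) (triple _ _ _ p q r)

  swap₁₂ : (p : a ≢ b) (q : a ≢ c) (r : b ≢ c) →
           χ (triple a c b q p (≢-sym r)) ≡ Sign.opposite (χ (triple a b c p q r))
  swap₁₂ p q r = alternating (transpose 1F 2F) (triple _ _ _ p q r)

  rot : Positive a b c → Positive b c a
  rot (positive p q r e) = positive r (≢-sym p) (≢-sym q)
    (trans (swap₁₂ (≢-sym p) r q) (cong Sign.opposite (trans (swap₀₁ p q r) (cong Sign.opposite e))))

  rot² : Positive a b c → Positive c a b
  rot² = rot ∘ rot

  asym : Positive a b c → ¬ Positive b a c
  asym (positive p q r e) (positive _ _ _ e′)
    with trans (sym e′) (trans (swap₀₁ p q r) (cong Sign.opposite e))
  ... | ()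

  total : a ≢ b → a ≢ c → b ≢ c → Positive a b c ⊎ Positive b a c
  total p q r with χ (triple _ _ _ p q r) in eq
  ... | Sign.+ = inj₁ (positive p q r eq)
  ... | Sign.- = inj₂ (positive (≢-sym p) r q (trans (swap₀₁ p q r) (cong Sign.opposite eq)))

  ¬positive⇒positive : a ≢ b → a ≢ c → b ≢ c → ¬ Positive a b c → Positive b a c
  ¬positive⇒positive p q r ¬abc = [ (λ abc → contradiction abc ¬abc) , (λ bac → bac) ]′ (total p q r)

  ¬positive-irreflʳ : ¬ Positive a b b
  ¬positive-irreflʳ abb = b≢c abb refl

  positive? : ∀ a b c → Dec (Positive a b c)
  positive? a b c with a ≟ b | a ≟ c | b ≟ c
  ... | yes p | _     | _     = no λ t → a≢b t p
  ... | no _  | yes q | _     = no λ t → a≢c t q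
  ... | no _  | no _  | yes r = no λ t → b≢c t r
  ... | no p  | no q  | no r  = map′ (positive p q r) χ≡+ (χ (triple a b c p q r) Sign.≟ Sign.+)

  -- Knuth's interiority axiom for CC systems: a lies inside the triangle bcd.
  interior : Positive a b c → Positive a c d → Positive a d b → Positive b c d
  interior abc acd adb
    with χ (triple _ _ _ (b≢c abc) (≢-sym (b≢c adb)) (b≢c acd)) in χbcd
  ... | Sign.+ = positive (b≢c abc) (≢-sym (b≢c adb)) (b≢c acd) χbcd
  ... | Sign.- = contradiction
    (atMostTwo _ _ _ _ (a≢b abc) (a≢c abc) (a≢c acd) (b≢c abc) (≢-sym (b≢c adb)) (b≢c acd))
    (+-+-⇒≰2 (χ≡+ abc)
      (trans (swap₁₂ (a≢b adb) (a≢c adb) (b≢c adb)) (cong Sign.opposite (χ≡+ adb)))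
      (χ≡+ acd) χbcd)

  -- Stated through negations, the conditions hold trivially for x ∈ {i, j}.
  record SeparatesOn (xs : List (Fin n)) (A B : Subset n) (i j : Fin n) : Set where
    constructor separates
    field
      onA : x ∈ₗ xs → x ∈ A → ¬ Positive j i x
      onB : x ∈ₗ xs → x ∈ B → ¬ Positive i j x

  open SeparatesOn

  -- Separability of four-element sets in list form.

  SeparableOn : List (Fin n) → (A B : Subset n) → Set
  SeparableOn xs A B = ∃[ i ] ∃[ j ] i ∈ₗ xs × j ∈ₗ xs × i ≢ j × SeparatesOn xs A B i j

  -- With four-element sets as lists, matching on the positions of i and j enumerates all sixteen
  -- candidate pairs.
  FourSeparable : (A B : Subset n) → Set
  FourSeparable A B = ∀ xs → length xs ≡ 4 → Unique xs → All (λ x → x ∈ A ⊎ x ∈ B) xs → SeparableOn xs A B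

  four-swap : FourSeparable A B → FourSeparable B A
  four-swap four xs len u xs⊆ with four xs len u (All.map Sum.swap xs⊆)
  ... | i , j , i∈ , j∈ , i≢j , s = j , i , j∈ , i∈ , ≢-sym i≢j , separates (onB s) (onA s)

  fourSeparable : (∀ C → C ⊆ A ∪ B → ∣ C ∣ ≡ 4 → Separable χ (A ∩ C) (B ∩ C)) → FourSeparable A B
  fourSeparable {A} {B} separable xs len u xs⊆
    with separable (fromList xs) (λ w∈ → x∈p∪q⁺ (All.lookup xs⊆ (∈-fromList⁻ xs w∈))) (trans (∣fromList∣ u) len)
  ... | i , j , i∈ , j∈ , i≢j , pos , neg = i , j , listed i∈ , listed j∈ , i≢j , separates
      (λ x∈ x∈A jix → asym jix (positive i≢j (b≢c jix) (a≢c jix)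
        (pos _ (x∈p∩q⁺ (x∈A , ∈-fromList⁺ x∈)) (b≢c jix) (a≢c jix))))
      (λ x∈ x∈B ijx → contradiction
        (trans (sym (χ≡+ ijx)) (neg _ (x∈p∩q⁺ (x∈B , ∈-fromList⁺ x∈)) (a≢c ijx) (b≢c ijx))) λ ())
    where
    listed : x ∈ (A ∩ fromList xs) ∪ (B ∩ fromList xs) → x ∈ₗ xs
    listed = ∈-fromList⁻ xs ∘ [ proj₂ ∘ x∈p∩q⁻ _ _ , proj₂ ∘ x∈p∩q⁻ _ _ ]′ ∘ x∈p∪q⁻ _ _

  StrongPair : (A B : Subset n) → Set
  StrongPair A B = ∃[ i ] ∃[ j ] i ∈ A × j ∈ B × i ≢ j ×
    (∀ {x} → x ∈ A → ¬ Positive j i x) × (∀ {x} → x ∈ B → ¬ Positive i j x)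

  strong-swap : StrongPair A B → StrongPair B A
  strong-swap (i , j , i∈ , j∈ , i≢j , onA , onB) = j , i , j∈ , i∈ , ≢-sym i≢j , onB , onA

  stronglySeparable : StrongPair A B → StronglySeparable χ A B
  stronglySeparable (i , j , i∈ , j∈ , i≢j , onA , onB) = i , j , i∈ , j∈ , i≢j
    , (λ x x∈ i≢x j≢x → χ≡+ (¬positive⇒positive (≢-sym i≢j) j≢x i≢x (onA x∈)))
    , (λ x x∈ i≢x j≢x → trans (swap₀₁ (≢-sym i≢j) j≢x i≢x)
        (cong Sign.opposite (χ≡+ (¬positive⇒positive i≢j i≢x j≢x (onB x∈)))))

  -- The order of B as seen from an element of A.

  -- By `interior`, a lies inside the positive triangle b₁b₂b₃, which fixes all four orientations.
  -- Every pair of distinct points then leaves some point on the wrong side.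
  acyclic : FourSeparable A B → ∀ {a b₁ b₂ b₃} → a ∈ A → b₁ ∈ B → b₂ ∈ B → b₃ ∈ B →
            Positive a b₁ b₂ → Positive a b₂ b₃ → ¬ Positive a b₃ b₁
  acyclic four {a} {b₁} {b₂} {b₃} a∈ b₁∈ b₂∈ b₃∈ t₁ t₂ t₃
    with interior t₁ t₂ t₃
       | four (a ∷ b₁ ∷ b₂ ∷ b₃ ∷ []) refl
           ((a≢b t₁ ∷ a≢c t₁ ∷ a≢c t₂ ∷ []) ∷ (b≢c t₁ ∷ ≢-sym (b≢c t₃) ∷ []) ∷ (b≢c t₂ ∷ []) ∷ [] ∷ [])
           (inj₁ a∈ ∷ inj₂ b₁∈ ∷ inj₂ b₂∈ ∷ inj₂ b₃∈ ∷ [])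
  ... | t₄ | _ , _ , 0th , 0th , i≢j , s = i≢j refl
  ... | t₄ | _ , _ , 0th , 1st , _   , s = onB s 2nd b₂∈ t₁
  ... | t₄ | _ , _ , 0th , 2nd , _   , s = onB s 3rd b₃∈ t₂
  ... | t₄ | _ , _ , 0th , 3rd , _   , s = onB s 1st b₁∈ t₃
  ... | t₄ | _ , _ , 1st , 0th , _   , s = onB s 3rd b₃∈ (rot² t₃)
  ... | t₄ | _ , _ , 1st , 1st , i≢j , s = i≢j refl
  ... | t₄ | _ , _ , 1st , 2nd , _   , s = onB s 3rd b₃∈ t₄
  ... | t₄ | _ , _ , 1st , 3rd , _   , s = onA s 0th a∈ (rot t₃)
  ... | t₄ | _ , _ , 2nd , 0th , _   , s = onB s 1st b₁∈ (rot² t₁)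
  ... | t₄ | _ , _ , 2nd , 1st , _   , s = onA s 0th a∈ (rot t₁)
  ... | t₄ | _ , _ , 2nd , 2nd , i≢j , s = i≢j refl
  ... | t₄ | _ , _ , 2nd , 3rd , _   , s = onB s 1st b₁∈ (rot t₄)
  ... | t₄ | _ , _ , 3rd , 0th , _   , s = onB s 2nd b₂∈ (rot² t₂)
  ... | t₄ | _ , _ , 3rd , 1st , _   , s = onB s 2nd b₂∈ (rot² t₄)
  ... | t₄ | _ , _ , 3rd , 2nd , _   , s = onA s 0th a∈ (rot t₂)
  ... | t₄ | _ , _ , 3rd , 3rd , i≢j , s = i≢j refl

  -- With + read as counterclockwise, b is the extreme point of B as seen from a. For b = a this
  -- would hold vacuously, whence the condition b′ ≢ a in `leftmost`, where a may belong to B.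
  Leftmost : (B : Subset n) (a b : Fin n) → Set
  Leftmost B a b = ∀ {y} → y ∈ B → ¬ Positive a b y

  -- A tournament without cyclic triples has a last element: on moving from b to some y beyond it, a
  -- z that was not beyond b is not beyond y either, as b, y, z would be cyclic around a.
  leftmost : FourSeparable A B → ∀ {a b} → a ∈ A → b ∈ B → b ≢ a → ∃[ b′ ] b′ ∈ B × b′ ≢ a × Leftmost B a b′
  leftmost {A} {B} four {a} {b₀} a∈ b₀∈ b₀≢a with exhaust improve (b₀ , b₀∈ , b₀≢a)
    where
    State : Set
    State = ∃[ b ] b ∈ B × b ≢ a

    improve : (s : State) (y : Fin n) → ∃[ s′ ] (y ∈ B → ¬ Positive a (proj₁ s′) y) ×
              (∀ {z} → (z ∈ B → ¬ Positive a (proj₁ s) z) → z ∈ B → ¬ Positive a (proj₁ s′) z)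
    improve s@(b , b∈ , b≢a) y with (y ∈? B) ×-dec positive? a b y
    ... | no ¬aby = s , (λ y∈ aby → ¬aby (y∈ , aby)) , λ keep → keep
    ... | yes (y∈ , aby) = (y , y∈ , ≢-sym (a≢c aby)) , (λ _ → ¬positive-irreflʳ) , mono
      where
      mono : ∀ {z} → (z ∈ B → ¬ Positive a b z) → z ∈ B → ¬ Positive a y z
      mono {z} ¬abz z∈ ayz with z ≟ b
      ... | yes refl = asym (rot aby) (rot ayz)
      ... | no z≢b = acyclic four a∈ b∈ y∈ z∈ aby ayz
        (rot (¬positive⇒positive (a≢b aby) (a≢c ayz) (≢-sym z≢b) (¬abz z∈)))
  ... | (b , b∈ , b≢a) , done = b , b∈ , b≢a , λ y∈ → done _ y∈

  -- Disjoint sets.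

  -- The four orientations put b, a, b′, a′ in convex position in this cyclic order. Elements of A
  -- and B alternate, so no pair separates them.
  no-wrong-swap : FourSeparable A B → ∀ {a a′ b b′} → a ∈ A → a′ ∈ A → b ∈ B → b′ ∈ B →
                  Positive b a a′ → Positive b a b′ → Positive b′ a′ b → ¬ Positive b′ a′ a
  no-wrong-swap four {a} {a′} {b} {b′} a∈ a′∈ b∈ b′∈ t₁ t₂ t₃ t₄
    with four (a ∷ a′ ∷ b ∷ b′ ∷ []) refl
           ((b≢c t₁ ∷ ≢-sym (a≢b t₁) ∷ b≢c t₂ ∷ []) ∷ (b≢c t₃ ∷ ≢-sym (a≢b t₃) ∷ []) ∷ (a≢c t₂ ∷ []) ∷ [] ∷ [])
           (inj₁ a∈ ∷ inj₁ a′∈ ∷ inj₂ b∈ ∷ inj₂ b′∈ ∷ [])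
  ... | _ , _ , 0th , 0th , i≢j , s = i≢j refl
  ... | _ , _ , 0th , 1st , _   , s = onB s 2nd b∈ (rot t₁)
  ... | _ , _ , 0th , 2nd , _   , s = onA s 1st a′∈ t₁
  ... | _ , _ , 0th , 3rd , _   , s = onB s 2nd b∈ (rot t₂)
  ... | _ , _ , 1st , 0th , _   , s = onB s 3rd b′∈ (rot t₄)
  ... | _ , _ , 1st , 1st , i≢j , s = i≢j refl
  ... | _ , _ , 1st , 2nd , _   , s = onB s 3rd b′∈ (rot t₃)
  ... | _ , _ , 1st , 3rd , _   , s = onA s 0th a∈ t₄
  ... | _ , _ , 2nd , 0th , _   , s = onB s 3rd b′∈ t₂
  ... | _ , _ , 2nd , 1st , _   , s = onA s 0th a∈ (rot² t₁)
  ... | _ , _ , 2nd , 2nd , i≢j , s = i≢j refl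
  ... | _ , _ , 2nd , 3rd , _   , s = onA s 0th a∈ (rot² t₂)
  ... | _ , _ , 3rd , 0th , _   , s = onA s 1st a′∈ (rot² t₄)
  ... | _ , _ , 3rd , 1st , _   , s = onB s 2nd b∈ t₃
  ... | _ , _ , 3rd , 2nd , _   , s = onA s 1st a′∈ (rot² t₃)
  ... | _ , _ , 3rd , 3rd , i≢j , s = i≢j refl

  -- The same alternating quadrilateral, in the cyclic order b′, p, b, q.
  no-crossing : FourSeparable A B → ∀ {p q b b′} → p ∈ A → q ∈ A → b ∈ B → b′ ∈ B →
                Positive b′ p b → Positive p b q → Positive b′ p q → ¬ Positive q b′ b
  no-crossing four {p} {q} {b} {b′} p∈ q∈ b∈ b′∈ t₁ t₂ t₃ t₄
    with four (p ∷ q ∷ b ∷ b′ ∷ []) refl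
           ((a≢c t₂ ∷ a≢b t₂ ∷ ≢-sym (a≢b t₁) ∷ []) ∷ (a≢c t₄ ∷ a≢b t₄ ∷ []) ∷ (≢-sym (a≢c t₁) ∷ []) ∷ [] ∷ [])
           (inj₁ p∈ ∷ inj₁ q∈ ∷ inj₂ b∈ ∷ inj₂ b′∈ ∷ [])
  ... | _ , _ , 0th , 0th , i≢j , s = i≢j refl
  ... | _ , _ , 0th , 1st , _   , s = onB s 3rd b′∈ (rot t₃)
  ... | _ , _ , 0th , 2nd , _   , s = onB s 3rd b′∈ (rot t₁)
  ... | _ , _ , 0th , 3rd , _   , s = onA s 1st q∈ t₃
  ... | _ , _ , 1st , 0th , _   , s = onB s 2nd b∈ (rot² t₂)
  ... | _ , _ , 1st , 1st , i≢j , s = i≢j refl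
  ... | _ , _ , 1st , 2nd , _   , s = onA s 0th p∈ (rot t₂)
  ... | _ , _ , 1st , 3rd , _   , s = onB s 2nd b∈ t₄
  ... | _ , _ , 2nd , 0th , _   , s = onA s 1st q∈ t₂
  ... | _ , _ , 2nd , 1st , _   , s = onB s 3rd b′∈ (rot² t₄)
  ... | _ , _ , 2nd , 2nd , i≢j , s = i≢j refl
  ... | _ , _ , 2nd , 3rd , _   , s = onA s 1st q∈ (rot t₄)
  ... | _ , _ , 3rd , 0th , _   , s = onB s 2nd b∈ t₁
  ... | _ , _ , 3rd , 1st , _   , s = onA s 0th p∈ (rot² t₃)
  ... | _ , _ , 3rd , 2nd , _   , s = onA s 0th p∈ (rot² t₁)
  ... | _ , _ , 3rd , 3rd , i≢j , s = i≢j refl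

  -- Pairs (a,b) and (a′,b′) separating the same four points would contradict `interior` at a.
  separator-unique : ∀ {a a′ b b′} → Positive a b a′ → Positive b a b′ →
                     Positive a′ b′ a → ¬ Positive b′ a′ b
  separator-unique aba′ bab′ a′b′a b′a′b =
    asym (rot² b′a′b) (rot² (interior aba′ (rot² a′b′a) (rot bab′)))

  module Disjoint {A B : Subset n} (four : FourSeparable A B) (disjoint : ∀ {x} → x ∈ A → x ∉ B) where

    A≢B : ∀ {a b} → a ∈ A → b ∈ B → a ≢ b
    A≢B a∈ b∈ refl = disjoint a∈ b∈

    -- Suppose z is on the wrong side of a′b′. If b′ = b, then z = a contradicts antisymmetry, and
    -- otherwise a, a′, z are cyclic around b. If b′ differs from b, then ab and zb′ both separate
    -- {a, z} from {b, b′}, against `separator-unique`.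
    exchange : ∀ {a a′ b b′ z} → a ∈ A → a′ ∈ A → b ∈ B → b′ ∈ B → z ∈ A →
               Leftmost B a b → Leftmost B a′ b′ →
               Positive b a a′ → ¬ Positive b a z → ¬ Positive b′ a′ z
    exchange {a} {a′} {b} {b′} {z} a∈ a′∈ b∈ b′∈ z∈ ab-left a′b′-left baa′ ¬baz b′a′z with b′ ≟ b | z ≟ a
    ... | yes refl | yes refl = asym (rot b′a′z) (rot baa′)
    ... | yes refl | no z≢a   = acyclic (four-swap four) b∈ a∈ a′∈ z∈ baa′ b′a′z
      (rot (¬positive⇒positive (a≢b baa′) (a≢c b′a′z) (≢-sym z≢a) ¬baz))
    ... | no b′≢b  | _        = separator-unique abz bab′ zb′a b′zb
      where
      bab′ = ¬positive⇒positive (A≢B a∈ b∈) (A≢B a∈ b′∈) (≢-sym b′≢b) (ab-left b′∈)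
      b′a′b = ¬positive⇒positive (A≢B a′∈ b′∈) (A≢B a′∈ b∈) b′≢b (a′b′-left b∈)
      -- The replaced element a is on the right side of the new pair, which disposes of z = a.
      ¬b′a′a = no-wrong-swap four a∈ a′∈ b∈ b′∈ baa′ bab′ b′a′b
      z≢a : z ≢ a
      z≢a refl = ¬b′a′a b′a′z
      abz = ¬positive⇒positive (a≢b baa′) (≢-sym (A≢B z∈ b∈)) (≢-sym z≢a) ¬baz
      a′b′a = ¬positive⇒positive (≢-sym (A≢B a′∈ b′∈)) (≢-sym (A≢B a∈ b′∈)) (≢-sym (b≢c baa′)) ¬b′a′a
      -- Otherwise a, a′, z would be cyclic around b; the same argument around b′ gives `zb′a`
      -- below.
      a′bz = ¬positive⇒positive (a≢c baa′) (≢-sym (A≢B z∈ b∈)) (b≢c b′a′z)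
        λ ba′z → acyclic (four-swap four) b∈ a∈ a′∈ z∈ baa′ ba′z (rot abz)
      b′zb = ¬positive⇒positive (A≢B z∈ b′∈) (A≢B z∈ b∈) b′≢b
        (no-crossing four a′∈ z∈ b∈ b′∈ b′a′b a′bz b′a′z)
      zb′a = ¬positive⇒positive (≢-sym (A≢B z∈ b′∈)) (≢-sym (A≢B a∈ b′∈)) z≢a
        λ b′za → acyclic (four-swap four) b′∈ a∈ a′∈ z∈ (rot a′b′a) b′a′z b′za

    strongPair : Nonempty A → Nonempty B → StrongPair A B
    strongPair (a₀ , a₀∈) (b₀ , b₀∈) with exhaust improve (a₀ , complete a₀∈)
      where
      -- The B side holds in every state by the choice of b; only A remains to be repaired.
      State : Set
      State = ∃[ a ] ∃[ b ] a ∈ A × b ∈ B × Leftmost B a b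

      complete : ∀ {a} → a ∈ A → ∃[ b ] a ∈ A × b ∈ B × Leftmost B a b
      complete a∈ with leftmost four a∈ b₀∈ (≢-sym (A≢B a∈ b₀∈))
      ... | b , b∈ , _ , left = b , a∈ , b∈ , left

      improve : (s : State) (y : Fin n) → let (a , b , _) = s in
                ∃[ s′ ] let (a′ , b′ , _) = s′ in (y ∈ A → ¬ Positive b′ a′ y) ×
                (∀ {z} → (z ∈ A → ¬ Positive b a z) → z ∈ A → ¬ Positive b′ a′ z)
      improve s@(a , b , a∈ , b∈ , left) y with (y ∈? A) ×-dec positive? b a y
      ... | no ¬bay = s , (λ y∈ bay → ¬bay (y∈ , bay)) , λ keep → keep
      ... | yes (y∈ , bay) with complete y∈
      ...   | s′@(_ , _ , b′∈ , left′) = (y , s′) , (λ _ → ¬positive-irreflʳ) , λ keep z∈ →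
        exchange a∈ y∈ b∈ b′∈ z∈ left left′ bay (keep z∈)
    ... | (a , b , a∈ , b∈ , left) , done = a , b , a∈ , b∈ , A≢B a∈ b∈ , (λ x∈ → done _ x∈) , left

  -- Sets with a common element.

  -- Off the pair, a common element would need both signs at once.
  common-lies-on-pair : ∀ {xs} → SeparatesOn xs A B i j → i ≢ j → x ∈ₗ xs → x ∈ A → x ∈ B → i ≢ x → ¬ j ≢ x
  common-lies-on-pair s i≢j x∈ x∈A x∈B i≢x j≢x = [ onB s x∈ x∈B , onA s x∈ x∈A ]′ (total i≢j i≢x j≢x)

  -- In a four-element list this cuts the ordered pairs of distinct points from twelve to six.
  through-common : ∀ {xs} → SeparableOn xs A B → x ∈ₗ xs → x ∈ A → x ∈ B →
                   ∃[ y ] y ∈ₗ xs × x ≢ y × (SeparatesOn xs A B x y ⊎ SeparatesOn xs A B y x)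
  through-common {x = x} (i , j , i∈ , j∈ , i≢j , s) x∈ x∈A x∈B with i ≟ x | j ≟ x
  ... | yes refl | _        = j , j∈ , i≢j , inj₁ s
  ... | no _     | yes refl = i , i∈ , ≢-sym i≢j , inj₂ s
  ... | no i≢x   | no j≢x   = contradiction j≢x (common-lies-on-pair s i≢j x∈ x∈A x∈B i≢x)

  -- Around x the points come in the order b′, a, b. The line xa has elements of B on both sides,
  -- and a line through x and one of b, b′ has a and the other one on the same side.
  common-transfer : FourSeparable A B → ∀ {x a b b′} → x ∈ A → x ∈ B → a ∈ A → b ∈ B → b′ ∈ B →
                    Positive a x b′ → Positive b x b′ → ¬ Positive x a b
  common-transfer four {x} {a} {b} {b′} x∈A x∈B a∈ b∈ b′∈ t₁ t₂ t₃
    with through-common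
           (four (x ∷ a ∷ b ∷ b′ ∷ []) refl
             ((a≢b t₃ ∷ a≢c t₃ ∷ b≢c t₁ ∷ []) ∷ (b≢c t₃ ∷ a≢c t₁ ∷ []) ∷ (a≢c t₂ ∷ []) ∷ [] ∷ [])
             (inj₁ x∈A ∷ inj₁ a∈ ∷ inj₂ b∈ ∷ inj₂ b′∈ ∷ []))
           0th x∈A x∈B
  ... | _ , 0th , x≢y , _      = x≢y refl
  ... | _ , 1st , _   , inj₁ s = onB s 2nd b∈ t₃
  ... | _ , 1st , _   , inj₂ s = onB s 3rd b′∈ t₁
  ... | _ , 2nd , _   , inj₁ s = onA s 1st a∈ (rot² t₃)
  ... | _ , 2nd , _   , inj₂ s = onB s 3rd b′∈ t₂
  ... | _ , 3rd , _   , inj₁ s = onB s 2nd b∈ (rot t₂)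
  ... | _ , 3rd , _   , inj₂ s = onA s 1st a∈ (rot t₁)

  -- Both common elements have to be ends of the separating pair, but the line xy has a and b on the
  -- same side.
  two-common : FourSeparable A B → ∀ {x y a b} → x ∈ A → x ∈ B → y ∈ A → y ∈ B → a ∈ A → b ∈ B → a ≢ b →
               Positive x y a → ¬ Positive x y b
  two-common four {x} {y} {a} {b} x∈A x∈B y∈A y∈B a∈ b∈ a≢b′ t₁ t₂
    with through-common
           (four (x ∷ y ∷ a ∷ b ∷ []) refl
             ((a≢b t₁ ∷ a≢c t₁ ∷ a≢c t₂ ∷ []) ∷ (b≢c t₁ ∷ b≢c t₂ ∷ []) ∷ (a≢b′ ∷ []) ∷ [] ∷ [])
             (inj₁ x∈A ∷ inj₁ y∈A ∷ inj₁ a∈ ∷ inj₂ b∈ ∷ []))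
           0th x∈A x∈B
  ... | _ , 0th , x≢y , _ = x≢y refl
  ... | _ , 1st , _   , inj₁ s = onB s 3rd b∈ t₂
  ... | _ , 1st , _   , inj₂ s = onA s 2nd a∈ t₁
  ... | _ , 2nd , _   , inj₁ s = onA s 1st y∈A (rot² t₁)
  ... | _ , 2nd , _   , inj₂ s = onB s 1st y∈B (rot² t₁)
  ... | _ , 3rd , _   , inj₁ s = onA s 1st y∈A (rot² t₂)
  ... | _ , 3rd , _   , inj₂ s = onB s 1st y∈B (rot² t₂)

  -- A pair misses one of three common elements, so a fourth element of A or B would complete them
  -- to an inseparable four-set.
  three-common : FourSeparable A B → ∀ {x y z} → Unique (x ∷ y ∷ z ∷ []) →
                 All (_∈ A) (x ∷ y ∷ z ∷ []) → All (_∈ B) (x ∷ y ∷ z ∷ []) →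
                 ∀ {w} → w ∈ A ⊎ w ∈ B → w ∈ₗ x ∷ y ∷ z ∷ []
  three-common {A} {B} four {x} {y} {z} u@((x≢y ∷ x≢z ∷ []) ∷ (y≢z ∷ []) ∷ [] ∷ [])
               all-A@(x∈A ∷ y∈A ∷ z∈A ∷ []) all-B@(x∈B ∷ y∈B ∷ z∈B ∷ []) {w} w∈ =
    decidable-stable (member? _≟_ w _) λ w∉ → impossible (¬Any⇒All¬ _ w∉)
    where
    impossible : ¬ All (w ≢_) (x ∷ y ∷ z ∷ [])
    impossible w≢@(w≢x ∷ w≢y ∷ w≢z ∷ [])
      with through-common (four (w ∷ x ∷ y ∷ z ∷ []) refl (w≢ ∷ u) (w∈ ∷ All.map inj₁ all-A)) 1st x∈A x∈B
    ... | _ , 0th , x≢w , inj₁ s = common-lies-on-pair s x≢w 2nd y∈A y∈B x≢y w≢y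
    ... | _ , 0th , x≢w , inj₂ s = common-lies-on-pair s w≢x 2nd y∈A y∈B w≢y x≢y
    ... | _ , 1st , x≢x , _      = x≢x refl
    ... | _ , 2nd , _   , inj₁ s = common-lies-on-pair s x≢y 3rd z∈A z∈B x≢z y≢z
    ... | _ , 2nd , _   , inj₂ s = common-lies-on-pair s (≢-sym x≢y) 3rd z∈A z∈B y≢z x≢z
    ... | _ , 3rd , _   , inj₁ s = common-lies-on-pair s x≢z 2nd y∈A y∈B x≢y (≢-sym y≢z)
    ... | _ , 3rd , _   , inj₂ s = common-lies-on-pair s (≢-sym x≢z) 2nd y∈A y∈B (≢-sym y≢z) x≢y

  -- The pair is ax. An element y of B on its wrong side would leave a between y and b around x,
  -- which `common-transfer` forbids.
  common-distinct : FourSeparable A B → ∀ {x a b} → x ∈ A → x ∈ B → a ∈ A → b ∈ B →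
                    Leftmost A x a → Leftmost B x b → Positive x a b → StrongPair A B
  common-distinct {A} {B} four {x} {a} {b} x∈A x∈B a∈ b∈ a-left b-left xab =
    a , x , a∈ , x∈B , ≢-sym (a≢b xab) , a-left , onB′
    where
    onB′ : ∀ {y} → y ∈ B → ¬ Positive a x y
    onB′ {y} y∈ axy = common-transfer four x∈A x∈B a∈ b∈ y∈ axy bxy xab
      where
      bxy = ¬positive⇒positive (a≢c xab) (b≢c axy)
        (λ { refl → asym axy xab }) (b-left y∈)

  -- The pair xb can fail only through some a in A, and bx only through some y in B. If both fail, a
  -- and y lie on the same side of bx, so `two-common` forces a = y.
  common-equal : FourSeparable A B → ¬ Exceptional A B → ∀ {x b} → x ∈ A → x ∈ B → b ∈ A → b ∈ B → b ≢ x →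
                 Leftmost A x b → Leftmost B x b → StrongPair A B
  common-equal {A} {B} four ¬exceptional {x} {b} x∈A x∈B b∈A b∈B b≢x A-left B-left
    with any? (λ a → (a ∈? A) ×-dec positive? b x a)
  ... | no none = x , b , x∈A , b∈B , ≢-sym b≢x , (λ a∈ bxa → none (_ , a∈ , bxa)) , B-left
  ... | yes (a , a∈ , bxa) = b , x , b∈A , x∈B , b≢x , A-left , onB′
    where
    onB′ : ∀ {y} → y ∈ B → ¬ Positive b x y
    onB′ {y} y∈ bxy with a ≟ y
    ... | no a≢y   = two-common four b∈A b∈B x∈A x∈B a∈ y∈ a≢y bxa bxy
    -- Now b, x and a are three common elements, so A = B has size three: an excluded exception.
    ... | yes refl with enumeration unique all-A all-B (three-common four unique all-A all-B)
      where
      unique : Unique (b ∷ x ∷ a ∷ [])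
      unique = (a≢b bxa ∷ a≢c bxa ∷ []) ∷ (b≢c bxa ∷ []) ∷ [] ∷ []
      all-A = b∈A ∷ x∈A ∷ a∈ ∷ []
      all-B = b∈B ∷ x∈B ∷ y∈ ∷ []
    ...   | A≡B , ∣A∣≡3 = ¬exceptional (A≡B , inj₂ ∣A∣≡3)

  another? : ∀ x (A : Subset n) → (∃[ a ] a ∈ A × a ≢ x) ⊎ (∀ {a} → a ∈ A → a ≡ x)
  another? x A with any? (λ a → (a ∈? A) ×-dec ¬? (a ≟ x))
  ... | yes found = inj₁ found
  ... | no none   = inj₂ λ {a} a∈ → decidable-stable (a ≟ x) λ a≢x → none (a , a∈ , a≢x)

  common-singleton : FourSeparable A B → ∀ {x b} → x ∈ A → b ∈ B → b ≢ x → (∀ {a} → a ∈ A → a ≡ x) →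
                     StrongPair A B
  common-singleton four {x} x∈A b∈ b≢x A-only with leftmost four x∈A b∈ b≢x
  ... | b′ , b′∈ , b′≢x , left = x , b′ , x∈A , b′∈ , ≢-sym b′≢x , onA′ , left
    where
    onA′ : ∀ {a} → a ∈ _ → ¬ Positive b′ x a
    onA′ a∈ rewrite A-only a∈ = ¬positive-irreflʳ

  common : FourSeparable A B → ¬ Exceptional A B → ∀ {x} → x ∈ A → x ∈ B → StrongPair A B
  common {A} {B} four ¬exceptional {x} x∈A x∈B with another? x A | another? x B
  ... | inj₂ A-only | inj₂ B-only
    with enumeration ([] ∷ []) (x∈A ∷ []) (x∈B ∷ []) [ here ∘ A-only , here ∘ B-only ]′
  -- Both sets consist of x alone, the exception of size one.
  ...   | A≡B , ∣A∣≡1 = contradiction (A≡B , inj₁ ∣A∣≡1) ¬exceptional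
  common four ¬exceptional x∈A x∈B | inj₂ A-only | inj₁ (_ , b∈ , b≢x) =
    common-singleton four x∈A b∈ b≢x A-only
  common four ¬exceptional x∈A x∈B | inj₁ (_ , a∈ , a≢x) | inj₂ B-only =
    strong-swap (common-singleton (four-swap four) x∈B a∈ a≢x B-only)
  common four ¬exceptional x∈A x∈B | inj₁ (_ , a₀∈ , a₀≢x) | inj₁ (_ , b₀∈ , b₀≢x)
    with leftmost (four-swap four) x∈B a₀∈ a₀≢x | leftmost four x∈A b₀∈ b₀≢x
  ... | a , a∈ , a≢x , a-left | b , b∈ , b≢x , b-left with a ≟ b
  ...   | yes refl = common-equal four ¬exceptional x∈A x∈B a∈ b∈ b≢x a-left b-left
  -- The sign of xab decides between the pairs ax and xb, which swapping A and B exchanges.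
  ...   | no a≢b with total (≢-sym a≢x) (≢-sym b≢x) a≢b
  ...     | inj₁ xab = common-distinct four x∈A x∈B a∈ b∈ a-left b-left xab
  ...     | inj₂ axb = strong-swap
    (common-distinct (four-swap four) x∈B x∈A b∈ a∈ b-left a-left (rot axb))

theorem1 : ∀ {n : ℕ} (χ : [ n ]₃ → Sign) → IsGeneralizedSignotope χ →
    (A B : Subset n) → Nonempty A → Nonempty B →
    ¬ (Exceptional A B) →
    (∀ (C : Subset n) → C ⊆ A ∪ B → ∣ C ∣ ≡ 4 → Separable χ (A ∩ C) (B ∩ C)) →
    StronglySeparable χ A B
theorem1 χ signotope A B A≢∅ B≢∅ ¬exceptional separable = stronglySeparable strongPair
  where
  open GeneralizedSignotope signotope

  four : FourSeparable A B
  four = fourSeparable separable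

  strongPair : StrongPair A B
  strongPair with any? (λ x → (x ∈? A) ×-dec (x ∈? B))
  ... | yes (_ , x∈A , x∈B) = common four ¬exceptional x∈A x∈B
  ... | no disjoint = Disjoint.strongPair four
    (λ x∈A x∈B → disjoint (_ , x∈A , x∈B)) A≢∅ B≢∅
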